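{- Let $k\ge1$ and $n$ be positive integers. Let $\Gamma(m)$ denote the least common multiple of $1,2,\dots,m$, and define $m_1=m_2=1$, $m_3=2$ and $m_{i+1}=2m_i(m_i-1)\Gamma(2m_i-1)$ for $i\ge3$. If $4m_{2k}$ divides $n$, then for any set $\{F_1,\dots,F_k\}$ of binary frequency squares of order $n$ (not necessarily pairwise orthogonal), there exists a binary frequency square $F$ of order $n$ that is orthogonal to every $F_i$, $1\le i\le k$.
   Context: A binary frequency square of order $n$ ($n$ even) is an $n\times n$ array with entries in $\{0,1\}$ in which each row and each column contains exactly $n/2$ zeros and $n/2$ ones. Two binary frequency squares of order $n$ are orthogonal if, when superimposed, each of the ordered pairs $(0,0),(0,1),(1,0),(1,1)$ occurs exactly $n^2/4$ times. -}

module Defs where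

open import Data.Nat using (ℕ; zero; suc; _+_; _*_; _∸_; _/_)
open import Data.Nat.LCM using (lcm)
open import Data.Bool using (Bool; true; false; _∧_; not)
open import Data.Fin using (Fin; zero; suc)
open import Data.Product using (_×_)
open import Relation.Binary.PropositionalEquality using (_≡_)

count : ∀ {m} → (Fin m → Bool) → ℕ
count {zero}  p = 0
count {suc m} p = (if p zero then 1 else 0) + count (λ i → p (suc i))
  where
  if_then_else_ : Bool → ℕ → ℕ → ℕ
  if true  then a else b = a
  if false then a else b = b

Γ : ℕ → ℕ
Γ zero    = 1
Γ (suc m) = lcm (suc m) (Γ m)

-- The sequence m_i, indexed from i = 1 (value at index 0 is an unused dummy 1):
-- m_1 = m_2 = 1, m_3 = 2, m_{i+1} = 2 m_i (m_i - 1) Γ(2 m_i - 1) for i ≥ 3.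
mseq : ℕ → ℕ
mseq 0 = 1
mseq 1 = 1
mseq 2 = 1
mseq 3 = 2
mseq (suc (suc (suc (suc i)))) =
  let a = mseq (suc (suc (suc i))) in 2 * a * (a ∸ 1) * Γ (2 * a ∸ 1)

-- An n × n array with entries in {0,1}; false = 0, true = 1.
Array : ℕ → Set
Array n = Fin n → Fin n → Bool

_==_ : Bool → Bool → Bool
true  == true  = true
false == false = true
_     == _     = false

IsBFS : (n : ℕ) → Array n → Set
IsBFS n F =
  (∀ i → count (λ j → F i j == false) ≡ n / 2 × count (λ j → F i j == true) ≡ n / 2) ×
  (∀ j → count (λ i → F i j == false) ≡ n / 2 × count (λ i → F i j == true) ≡ n / 2)

sumF : ∀ {m} → (Fin m → ℕ) → ℕ
sumF {zero}  f = 0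
sumF {suc m} f = f zero + sumF (λ i → f (suc i))

pairCount : ∀ {n} → Array n → Array n → Bool → Bool → ℕ
pairCount F G a b = sumF (λ i → count (λ j → (F i j == a) ∧ (G i j == b)))

Orthogonal : (n : ℕ) → Array n → Array n → Set
Orthogonal n F G = ∀ a b → pairCount F G a b ≡ (n * n) / 4

{-# OPTIONS --safe #-}
module Submission where

-- F is built from complementary pairs of rows: row r is a vector g and row r + n/2 is its
-- complement.  The columns of F are then balanced for free, and F is orthogonal to F_i as soon as
-- every g is balanced and orthogonal to f_i = F_i[r] - F_i[r + n/2], a zero-sum vector with entries
-- in {-1, 0, 1}.  Such a g exists if the columns can be cut into an even number of blocks of equal
-- size on each of which every f_i sums to zero.  Blocks are produced one coordinate at a time:
-- blocks of size a, zero-sum for f_2, ..., f_k, have f_1-sums in [-a, a], and they are merged into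
-- larger blocks using that zero-sum sequences in [-a, a] split into zero-sum pieces of length at
-- most L = 2a - 1, hence into groups of exactly (L - 1) Γ(L) terms.  The block sizes obtained for
-- k coordinates are m_{k+2}, and 2 m_{k+2} divides 4 m_{2k}.

open import Defs
open import Data.Bool using (Bool; true; false; _∧_; not)
open import Data.Fin as Fin using (Fin; toℕ; fromℕ<; _↑ˡ_; _↑ʳ_; splitAt)
import Data.Fin.Properties as Fin
open import Data.Integer using (ℤ; +_; -[1+_]; -_; _-_; 0ℤ; +≤+; -≤+; _≤?_; ∣_∣)
import Data.Integer as ℤ
import Data.Integer.Properties as ℤ
open import Algebra.Properties.AbelianGroup ℤ.+-0-abelianGroup
  using (∙-cancelˡ; ∙-cancelʳ; inverseʳ-unique)
open import Data.Integer.Tactic.RingSolver using (solve-∀)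
open import Data.List using (List; []; _∷_; _++_; length; take; drop; concat; map; tabulate; allFin)
import Data.List.Membership.DecPropositional as DecMembership
open import Data.List.Membership.Propositional using (_∈_)
open import Data.List.Membership.Propositional.Properties using (∈-++⁺ʳ)
import Data.List.Properties as List
open import Data.List.Relation.Binary.Permutation.Propositional
  using (_↭_; refl; prep; swap; trans; ↭-sym; ↭-reflexive; ↭⇒↭ₛ)
import Data.List.Relation.Binary.Permutation.Propositional.Properties as ↭
import Data.List.Relation.Binary.Permutation.Setoid.Properties as ↭ₛ
open import Data.List.Relation.Unary.All using (All; []; _∷_)
import Data.List.Relation.Unary.All as All
import Data.List.Relation.Unary.All.Properties as All
open import Data.List.Relation.Unary.AllPairs using (_∷_)
open import Data.List.Relation.Unary.Any using (here; there)
open import Data.List.Relation.Unary.Unique.Propositional using (Unique)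
open import Data.List.Relation.Unary.Unique.Propositional.Properties using (allFin⁺)
open import Data.Nat as ℕ using (ℕ; zero; suc; _*_; _≤_; z≤n; s≤s; NonZero)
open import Data.Nat.DivMod using (m*n/n≡m)
open import Data.Nat.Divisibility
  using (_∣_; divides; ∣-refl; ∣-trans; 1∣_; m∣m*n; n∣m*n; ∣m⇒∣m*n; *-pres-∣; *-cancelʳ-∣)
open import Data.Nat.GCD using (gcd)
open import Data.Nat.LCM using (gcd*lcm; m∣lcm[m,n]; n∣lcm[m,n])
import Data.Nat.Properties as ℕ
import Data.Nat.Tactic.RingSolver as ℕRing
open import Data.Product using (Σ; ∃; ∃₂; _×_; _,_; proj₁; proj₂)
open import Data.Sum using (_⊎_; inj₁; inj₂; [_,_]′)
open import Function using (_∘_)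
open import Relation.Binary.PropositionalEquality
  using (_≡_; refl; sym; cong; cong₂; subst; subst₂; setoid; module ≡-Reasoning)
  renaming (trans to ≡-trans)
open import Relation.Nullary using (¬_; yes; no; contradiction; does)
open import Relation.Nullary.Decidable using (dec-true; dec-false)
open import Relation.Unary using (Decidable)

-- Short zero-sum sublists

pick : ∀ {A : Set} {P : A → Set} → Decidable P → (xs : List A) →
       All (¬_ ∘ P) xs ⊎ ∃₂ λ x ys → P x × xs ↭ x ∷ ys
pick P? [] = inj₁ []
pick P? (x ∷ xs) with P? x
... | yes px = inj₂ (x , xs , px , refl)
... | no ¬px with pick P? xs
...   | inj₁ none = inj₁ (¬px ∷ none)
...   | inj₂ (y , ys , py , p) = inj₂ (y , x ∷ ys , py , trans (prep x p) (swap x y refl))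

take-+ : ∀ {A : Set} i d (xs : List A) → take (i ℕ.+ d) xs ≡ take i xs ++ take d (drop i xs)
take-+ zero    d xs       = refl
take-+ (suc i) d []       = sym (List.take-[] d)
take-+ (suc i) d (x ∷ xs) = cong (x ∷_) (take-+ i d xs)

total : ∀ {A : Set} → (A → ℤ) → List A → ℤ
total w []       = 0ℤ
total w (x ∷ xs) = w x ℤ.+ total w xs

module _ {A : Set} (w : A → ℤ) where

  total-++ : ∀ xs ys → total w (xs ++ ys) ≡ total w xs ℤ.+ total w ys
  total-++ []       ys = sym (ℤ.+-identityˡ _)
  total-++ (x ∷ xs) ys = ≡-trans (cong (λ t → w x ℤ.+ t) (total-++ xs ys)) (sym (ℤ.+-assoc (w x) _ _))

  total-↭ : ∀ {xs ys} → xs ↭ ys → total w xs ≡ total w ys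
  total-↭ refl = refl
  total-↭ (prep x p) = cong (λ t → w x ℤ.+ t) (total-↭ p)
  total-↭ (swap {xs = xs} {ys = ys} x y p) = begin
    w x ℤ.+ (w y ℤ.+ total w xs) ≡⟨ cong (λ t → w x ℤ.+ (w y ℤ.+ t)) (total-↭ p) ⟩
    w x ℤ.+ (w y ℤ.+ total w ys) ≡⟨ ex (w x) (w y) (total w ys) ⟩
    w y ℤ.+ (w x ℤ.+ total w ys) ∎
    where
    open ≡-Reasoning
    ex : ∀ a b c → a ℤ.+ (b ℤ.+ c) ≡ b ℤ.+ (a ℤ.+ c)
    ex = solve-∀
  total-↭ (trans p q) = ≡-trans (total-↭ p) (total-↭ q)

  total-concat : ∀ xss → total w (concat xss) ≡ total (total w) xss
  total-concat []         = refl
  total-concat (xs ∷ xss) = ≡-trans (total-++ xs (concat xss)) (cong (λ t → total w xs ℤ.+ t) (total-concat xss))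

  total-zero : ∀ {xs} → All (λ x → w x ≡ 0ℤ) xs → total w xs ≡ 0ℤ
  total-zero []       = refl
  total-zero (p ∷ ps) = cong₂ ℤ._+_ p (total-zero ps)

  total-≥0 : ∀ {xs} → All (λ x → 0ℤ ℤ.≤ w x) xs → 0ℤ ℤ.≤ total w xs
  total-≥0 []       = ℤ.≤-refl
  total-≥0 (p ∷ ps) = ℤ.+-mono-≤ p (total-≥0 ps)

  total-≤0 : ∀ {xs} → All (λ x → w x ℤ.≤ 0ℤ) xs → total w xs ℤ.≤ 0ℤ
  total-≤0 []       = ℤ.≤-refl
  total-≤0 (p ∷ ps) = ℤ.+-mono-≤ p (total-≤0 ps)

  Zero : List A → Set
  Zero xs = total w xs ≡ 0ℤ

  Within : ℤ → ℤ → List A → Set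
  Within lo hi = All (λ x → lo ℤ.≤ w x × w x ℤ.≤ hi)

  Zero-split : ∀ {xs} ys zs → xs ↭ ys ++ zs → Zero xs → Zero ys → Zero zs
  Zero-split {xs} ys zs p xs0 ys0 = begin
    total w zs                   ≡⟨ ℤ.+-identityˡ _ ⟨
    0ℤ ℤ.+ total w zs            ≡⟨ cong (ℤ._+ total w zs) ys0 ⟨
    total w ys ℤ.+ total w zs    ≡⟨ total-++ ys zs ⟨
    total w (ys ++ zs)           ≡⟨ total-↭ p ⟨
    total w xs                   ≡⟨ xs0 ⟩
    0ℤ                           ∎
    where open ≡-Reasoning

  -- Were all terms negative, a nonempty list would have a negative total. The list is given as
  -- `x ∷ xs` because the empty list also has total 0; in the strict companion `pick-<0` the
  -- hypothesis itself excludes it.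
  pick-≥0 : ∀ x xs → 0ℤ ℤ.≤ total w (x ∷ xs) →
            ∃₂ λ y ys → 0ℤ ℤ.≤ w y × x ∷ xs ↭ y ∷ ys
  pick-≥0 x xs h with pick (λ y → 0ℤ ≤? w y) (x ∷ xs)
  ... | inj₂ found = found
  ... | inj₁ (¬p ∷ ¬ps) = contradiction
    (ℤ.≤-<-trans h (ℤ.+-mono-<-≤ (ℤ.≰⇒> ¬p) (total-≤0 (All.map (ℤ.<⇒≤ ∘ ℤ.≰⇒>) ¬ps))))
    (ℤ.<-irrefl refl)

  pick-<0 : ∀ xs → total w xs ℤ.< 0ℤ →
            ∃₂ λ y ys → w y ℤ.< 0ℤ × xs ↭ y ∷ ys
  pick-<0 xs h with pick (λ y → w y ℤ.<? 0ℤ) xs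
  ... | inj₂ found = found
  ... | inj₁ none  = contradiction (ℤ.<-≤-trans h (total-≥0 (All.map ℤ.≮⇒≥ none))) (ℤ.<-irrefl refl)

  -- Appending a term ≥ 0 when the running sum is ≤ 0 and a term < 0 otherwise
  -- keeps the running sum inside an interval with only a + b + 1 integers.
  arrange : ∀ {a b} m xs → length xs ≡ m → Within -[1+ b ] (+ a) xs →
            ∀ s → s ℤ.+ total w xs ≡ 0ℤ → - + b ℤ.≤ s → s ℤ.≤ + a →
            ∃ λ ys → xs ↭ ys ×
              ∀ i → - + b ℤ.≤ s ℤ.+ total w (take i ys) × s ℤ.+ total w (take i ys) ℤ.≤ + a
  arrange {a} {b} zero [] _ _ s _ lo hi = [] , refl , λ i →
    subst (λ t → - + b ℤ.≤ s ℤ.+ total w t × s ℤ.+ total w t ℤ.≤ + a) (sym (List.take-[] i))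
      (subst (λ t → - + b ℤ.≤ t × t ℤ.≤ + a) (sym (ℤ.+-identityʳ s)) (lo , hi))
  arrange {a} {b} (suc m) (x ∷ xs) len bd s e lo hi = continue next
    where
    opp : total w (x ∷ xs) ≡ - s
    opp = inverseʳ-unique s _ e

    Next = ∃₂ λ y ys → x ∷ xs ↭ y ∷ ys × - + b ℤ.≤ s ℤ.+ w y × s ℤ.+ w y ℤ.≤ + a

    bound : ∀ {y ys} → x ∷ xs ↭ y ∷ ys → -[1+ b ] ℤ.≤ w y × w y ℤ.≤ + a
    bound p = All.head (↭.All-resp-↭ p bd)

    next : Next
    -- The remaining terms sum to `- s`, so a term of the sign required by the greedy rule is always
    -- available.
    next with s ≤? 0ℤ
    ... | yes s≤0 =
      let y , ys , y≥0 , p = pick-≥0 x xs (subst (0ℤ ℤ.≤_) (sym opp) (ℤ.neg-mono-≤ s≤0))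
      in y , ys , p
       , subst (ℤ._≤ s ℤ.+ w y) (ℤ.+-identityʳ _) (ℤ.+-mono-≤ lo y≥0)
       , subst (s ℤ.+ w y ℤ.≤_) (ℤ.+-identityˡ _) (ℤ.+-mono-≤ s≤0 (proj₂ (bound p)))
    ... | no s≰0 =
      let y , ys , y<0 , p = pick-<0 (x ∷ xs) (subst (ℤ._< 0ℤ) (sym opp) (ℤ.neg-mono-< (ℤ.≰⇒> s≰0)))
      in y , ys , p
       -- From `s ≥ 1` and `w y ≥ -(b + 1)` follows `s + w y ≥ -b`. Integrality gains the one unit
       -- by which terms may lie below the interval of running sums.
       , subst (ℤ._≤ s ℤ.+ w y) (suc-neg b) (ℤ.+-mono-≤ (ℤ.i<j⇒suc[i]≤j (ℤ.≰⇒> s≰0)) (proj₁ (bound p)))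
       , subst (s ℤ.+ w y ℤ.≤_) (ℤ.+-identityʳ _) (ℤ.+-mono-≤ hi (ℤ.<⇒≤ y<0))
      where
      suc-neg : ∀ b → + 1 ℤ.+ -[1+ b ] ≡ - + b
      suc-neg zero    = refl
      suc-neg (suc b) = refl

    continue : Next → _
    continue (y , ys , p , lo′ , hi′) =
      let zs , q , inside = arrange m ys
            (ℕ.suc-injective (≡-trans (sym (↭.↭-length p)) len))
            (All.tail (↭.All-resp-↭ p bd)) (s ℤ.+ w y)
            (≡-trans (ℤ.+-assoc s (w y) _) (≡-trans (cong (λ t → s ℤ.+ t) (sym (total-↭ p))) e))
            lo′ hi′
      in y ∷ zs , trans p (prep y q) , λ
        { zero    → subst (λ t → - + b ℤ.≤ t × t ℤ.≤ + a) (sym (ℤ.+-identityʳ s)) (lo , hi)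
        ; (suc i) → subst (λ t → - + b ℤ.≤ t × t ℤ.≤ + a) (ℤ.+-assoc s (w y) _) (inside i) }

  Small : ℕ → List A → Set
  Small L xs = ∃₂ λ ys zs → xs ↭ ys ++ zs × Zero ys × 1 ℕ.≤ length ys × length ys ℕ.≤ L

  offset : ∀ {a b} t → - + b ℤ.≤ t → t ℤ.≤ + a →
           Σ (Fin (suc (a ℕ.+ b))) λ k → + toℕ k ≡ t ℤ.+ + b
  offset {a} {b} t lo hi = fromℕ< bound , ≡-trans (cong +_ (Fin.toℕ-fromℕ< bound)) abs
    where
    abs : + ∣ t ℤ.+ + b ∣ ≡ t ℤ.+ + b
    abs = ℤ.0≤i⇒+∣i∣≡i (subst (ℤ._≤ t ℤ.+ + b) (ℤ.+-inverseˡ (+ b)) (ℤ.+-monoˡ-≤ (+ b) lo))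
    bound : ∣ t ℤ.+ + b ∣ ℕ.< suc (a ℕ.+ b)
    bound = s≤s (ℤ.drop‿+≤+ (subst (ℤ._≤ + (a ℕ.+ b)) (sym abs) (ℤ.+-monoˡ-≤ (+ b) hi)))

  -- After `arrange`, the prefixes of lengths 0 to a + b + 1 have sums in [-b, a]. These are a + b +
  -- 2 prefixes but only a + b + 1 possible values, so two sums coincide and the segment between the
  -- two cuts is zero-sum.
  small-zero-sum : ∀ {a b} xs → 1 ℕ.≤ length xs → Within -[1+ b ] (+ a) xs → Zero xs →
                   Small (suc (a ℕ.+ b)) xs
  small-zero-sum {a} {b} xs ne bd xs0 with length xs ℕ.≤? suc (a ℕ.+ b)
  ... | yes short = xs , [] , ↭-reflexive (sym (List.++-identityʳ xs)) , xs0 , ne , short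
  ... | no long
    with ys , p , inside ← arrange (length xs) xs refl bd 0ℤ
                             (≡-trans (ℤ.+-identityˡ _) xs0) ℤ.neg-≤-pos (+≤+ z≤n)
    with slot ← (λ t → offset {a} {b} _ (proj₁ (inside t)) (proj₂ (inside t)))
    with i , j , i<j , same ← Fin.pigeonhole (ℕ.n<1+n (suc (a ℕ.+ b))) (proj₁ ∘ slot ∘ toℕ)
    = mid , take i′ ys ++ drop d rest , perm , mid0 , mid≥1 , mid≤
    where
    i′ = toℕ i
    d  = toℕ j ℕ.∸ i′
    rest = drop i′ ys
    mid = take d rest

    i+d : i′ ℕ.+ d ≡ toℕ j
    i+d = ℕ.m+[n∸m]≡n (ℕ.<⇒≤ i<j)

    P : ℕ → ℤ
    P t = 0ℤ ℤ.+ total w (take t ys)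

    P-eq : P i′ ≡ P (toℕ j)
    P-eq = ∙-cancelʳ (+ b) (P i′) (P (toℕ j)) (≡-trans (sym (proj₂ (slot i′)))
             (≡-trans (cong (+_ ∘ toℕ) same) (proj₂ (slot (toℕ j)))))

    mid0 : Zero mid
    mid0 = ∙-cancelˡ (P i′) (total w mid) 0ℤ (begin
      P i′ ℤ.+ total w mid                      ≡⟨ ℤ.+-assoc 0ℤ (total w (take i′ ys)) (total w mid) ⟩
      0ℤ ℤ.+ (total w (take i′ ys) ℤ.+ total w mid) ≡⟨ cong (λ t → 0ℤ ℤ.+ t) (total-++ (take i′ ys) mid) ⟨
      0ℤ ℤ.+ total w (take i′ ys ++ mid)        ≡⟨ cong (λ t → 0ℤ ℤ.+ total w t) (take-+ i′ d ys) ⟨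
      P (i′ ℕ.+ d)                              ≡⟨ cong P i+d ⟩
      P (toℕ j)                                 ≡⟨ P-eq ⟨
      P i′                                      ≡⟨ ℤ.+-identityʳ (P i′) ⟨
      P i′ ℤ.+ 0ℤ                               ∎)
      where open ≡-Reasoning

    perm : xs ↭ mid ++ (take i′ ys ++ drop d rest)
    perm = trans p (trans
      (↭-reflexive (≡-trans (sym (List.take++drop≡id i′ ys))
        (cong (take i′ ys ++_) (sym (List.take++drop≡id d rest)))))
      (↭.shifts (take i′ ys) mid))

    j≤ : toℕ j ℕ.≤ suc (a ℕ.+ b)
    j≤ = ℕ.≤-pred (Fin.toℕ<n j)

    -- `take` and `drop` truncate silently. In this branch the list has more than a + b + 1 terms,
    -- so the cut at `j` falls inside it and the segment is nonempty.
    len-mid : length mid ≡ d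
    len-mid = ≡-trans (List.length-take d rest) (ℕ.m≤n⇒m⊓n≡m (subst (d ℕ.≤_) (sym (List.length-drop i′ ys))
      (ℕ.∸-monoˡ-≤ i′ (ℕ.≤-trans j≤ (subst (_ ℕ.≤_) (↭.↭-length p) (ℕ.<⇒≤ (ℕ.≰⇒> long)))))))

    mid≥1 : 1 ℕ.≤ length mid
    mid≥1 = subst (1 ℕ.≤_) (sym len-mid) (ℕ.m<n⇒0<n∸m i<j)

    mid≤ : length mid ℕ.≤ suc (a ℕ.+ b)
    mid≤ = subst (ℕ._≤ _) (sym len-mid) (ℕ.≤-trans (ℕ.m∸n≤m (toℕ j) i′) j≤)

-- Equal-sized zero-sum groups

↭-concat : ∀ {A : Set} {xss yss : List (List A)} → xss ↭ yss → concat xss ↭ concat yss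
↭-concat refl = refl
↭-concat (prep xs p) = ↭.++⁺ˡ xs (↭-concat p)
↭-concat (swap xs ys p) = trans (↭.shifts xs ys) (↭.++⁺ˡ ys (↭.++⁺ˡ xs (↭-concat p)))
↭-concat (trans p q) = trans (↭-concat p) (↭-concat q)

length-concat : ∀ {A : Set} {m} {xss : List (List A)} →
                All (λ xs → length xs ≡ m) xss → length (concat xss) ≡ length xss ℕ.* m
length-concat []                    = refl
length-concat (_∷_ {xs} {xss} p ps) =
  ≡-trans (List.length-++ xs) (cong₂ ℕ._+_ p (length-concat ps))

↭-++-length : ∀ {A : Set} {xs : List A} ys {zs} → xs ↭ ys ++ zs →
              length xs ≡ length ys ℕ.+ length zs
↭-++-length ys p = ≡-trans (↭.↭-length p) (List.length-++ ys)

module _ {A : Set} (w : A → ℤ) where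

  Zero-++ : ∀ xs ys → Zero w xs → Zero w ys → Zero w (xs ++ ys)
  Zero-++ xs ys p q = ≡-trans (total-++ w xs ys) (cong₂ ℤ._+_ p q)

  Zero-concat : ∀ {xss} → All (Zero w) xss → Zero w (concat xss)
  Zero-concat {xss} ps = ≡-trans (total-concat w xss) (total-zero (total w) ps)

  -- Splits off the pieces of the maximal length `suc l`, so that `gather` can either take its group
  -- from them or recurse on the bound `l`.
  classify : ∀ l ps → All (λ p → Zero w p × length p ℕ.≤ suc l) ps →
             ∃₂ λ qs rs → concat ps ↭ concat qs ++ concat rs ×
               All (λ q → Zero w q × length q ≡ suc l) qs ×
               All (λ r → Zero w r × length r ℕ.≤ l) rs
  classify l [] [] = [] , [] , refl , [] , []
  classify l (p ∷ ps) ((p0 , p≤) ∷ good) with classify l ps good | length p ℕ.≟ suc l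
  ... | qs , rs , perm , gq , gr | yes eq =
    p ∷ qs , rs
    , trans (↭.++⁺ˡ p perm) (↭-reflexive (sym (List.++-assoc p (concat qs) (concat rs))))
    , (p0 , eq) ∷ gq , gr
  ... | qs , rs , perm , gq , gr | no neq =
    qs , p ∷ rs , trans (↭.++⁺ˡ p perm) (↭.shifts p (concat qs))
    , gq , (p0 , ℕ.≤-pred (ℕ.≤∧≢⇒< p≤ neq)) ∷ gr

  Extracts : ℕ → List A → Set
  Extracts N xs = ∃₂ λ ys zs → xs ↭ ys ++ zs × Zero w ys × length ys ≡ N

  -- Some length d ≤ l carries at least N elements among the pieces of length d;
  -- N / d of those pieces are taken.
  gather : ∀ N l ps → (∀ d → d ℕ.< l → suc d ∣ N) →
           All (λ p → Zero w p × length p ℕ.≤ l) ps →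
           l ℕ.* N ℕ.≤ length (concat ps) → 0 ℕ.< length (concat ps) →
           Extracts N (concat ps)
  gather N zero ps dvd good _ pos = contradiction
    (≡-trans (length-concat (All.map (ℕ.n≤0⇒n≡0 ∘ proj₂) good)) (ℕ.*-zeroʳ (length ps)))
    (ℕ.>⇒≢ pos)
  gather N (suc l) ps dvd good big pos
    with qs , rs , perm , gq , gr ← classify l ps good
    with N ℕ.≤? length (concat qs)
  ... | yes N≤ with divides c refl ← dvd l ℕ.≤-refl =
    concat (take c qs) , concat (drop c qs) ++ concat rs
    , trans perm (trans
        (↭-reflexive (cong (_++ concat rs)
          (≡-trans (cong concat (sym (List.take++drop≡id c qs)))
                   (sym (List.concat-++ (take c qs) (drop c qs))))))
        (↭-reflexive (List.++-assoc (concat (take c qs)) (concat (drop c qs)) (concat rs))))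
    , Zero-concat (All.take⁺ c (All.map proj₁ gq))
    , ≡-trans (length-concat (All.take⁺ c (All.map proj₂ gq)))
              (cong (ℕ._* suc l) (≡-trans (List.length-take c qs) (ℕ.m≤n⇒m⊓n≡m c≤)))
    where
    c≤ : c ℕ.≤ length qs
    c≤ = ℕ.*-cancelʳ-≤ c (length qs) (suc l)
           (subst (c ℕ.* suc l ℕ.≤_) (length-concat (All.map proj₂ gq)) N≤)
  ... | no N≰ =
    let ys , zs , p , ys0 , len = gather N l rs (λ d → dvd d ∘ ℕ.m≤n⇒m≤1+n) gr
                                    (ℕ.<⇒≤ rest) (ℕ.≤-trans (s≤s z≤n) rest)
    in ys , concat qs ++ zs
     , trans perm (trans (↭.++⁺ˡ (concat qs) p) (↭.shifts (concat qs) ys)) , ys0 , len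
    where
    -- The pieces of length `suc l` hold fewer than `N` elements, so more than `l * N` lie in
    -- shorter ones. The strict inequality also gives the positivity needed by the recursive call.
    rest : l ℕ.* N ℕ.< length (concat rs)
    rest = ℕ.+-cancelˡ-< (length (concat qs)) _ _
      (ℕ.<-≤-trans (ℕ.+-monoˡ-< (l ℕ.* N) (ℕ.≰⇒> N≰))
        (subst (N ℕ.+ l ℕ.* N ℕ.≤_) (↭-++-length (concat qs) perm) big))

  -- The length bound is `L = c + 2` and `N` is any common multiple of 1, ..., L. `G` is a condition
  -- on single terms, hence inherited by whatever remains after an extraction.
  module _ {G : A → Set} (c N : ℕ) (dvd : ∀ d → d ℕ.< suc (suc c) → suc d ∣ N) (N≥1 : 1 ℕ.≤ N)
           (small : ∀ xs → 1 ℕ.≤ length xs → All G xs → Zero w xs → Small w (suc (suc c)) xs)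
           where

    private L = suc (suc c)

    -- Short zero-sum sublists are removed until nothing is left. Each is nonempty, so the length
    -- bound `m` serves as the recursion measure.
    decompose : ∀ m xs → length xs ℕ.≤ m → All G xs → Zero w xs →
                ∃ λ ps → xs ↭ concat ps × All (λ p → Zero w p × length p ℕ.≤ L) ps
    decompose m [] _ _ _ = [] , refl , []
    decompose (suc m) xs@(_ ∷ _) len good xs0 =
      let ys , zs , p , ys0 , ys≥1 , ys≤ = small xs (s≤s z≤n) good xs0
          ps , q , gps = decompose m zs
            (ℕ.+-cancelˡ-≤ 1 _ _ (ℕ.≤-trans (ℕ.+-monoˡ-≤ (length zs) ys≥1)
              (subst (ℕ._≤ suc m) (↭-++-length ys p) len)))
            (All.++⁻ʳ ys (↭.All-resp-↭ p good)) (Zero-split w ys zs p xs0 ys0)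
      in ys ∷ ps , trans p (↭.++⁺ˡ ys q) , (ys0 , ys≤) ∷ gps

    extract : ∀ xs → All G xs → Zero w xs → L ℕ.* N ℕ.≤ length xs → Extracts N xs
    extract xs good xs0 big =
      let ps , p , gps = decompose (length xs) xs ℕ.≤-refl good xs0
          big′ = subst (L ℕ.* N ℕ.≤_) (↭.↭-length p) big
          ys , zs , q , r = gather N L ps dvd gps big′
            (ℕ.≤-trans N≥1 (ℕ.≤-trans (ℕ.m≤n*m N L) big′))
      in ys , zs , trans p q , r

    -- An extraction needs `L * N` elements present and uses up only `N` of them, so after `e`
    -- extractions from `(e + L) * N` elements one more is still possible.
    extract-many : ∀ e xs → All G xs → Zero w xs → (e ℕ.+ L) ℕ.* N ℕ.≤ length xs →
                   Extracts (suc e ℕ.* N) xs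
    extract-many zero xs good xs0 big =
      let ys , zs , p , ys0 , len = extract xs good xs0 big
      in ys , zs , p , ys0 , ≡-trans len (sym (ℕ.*-identityˡ N))
    extract-many (suc e) xs good xs0 big =
      let ys , zs , p , ys0 , len = extract xs good xs0
            (ℕ.≤-trans (ℕ.*-monoˡ-≤ N (ℕ.m≤n+m L (suc e))) big)
          ys′ , zs′ , p′ , ys0′ , len′ = extract-many e zs
            (All.++⁻ʳ ys (↭.All-resp-↭ p good)) (Zero-split w ys zs p xs0 ys0)
            (ℕ.+-cancelˡ-≤ N _ _ (subst (N ℕ.+ (e ℕ.+ L) ℕ.* N ℕ.≤_)
              (≡-trans (↭-++-length ys p) (cong (ℕ._+ length zs) len)) big))
      in ys ++ ys′ , zs′
       , trans p (trans (↭.++⁺ˡ ys p′) (↭-reflexive (sym (List.++-assoc ys ys′ zs′))))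
       , Zero-++ ys ys′ ys0 ys0′
       , ≡-trans (List.length-++ ys) (cong₂ ℕ._+_ len len′)

    -- The group size (L - 1)N is chosen so that no remainder arises. While at least two groups are
    -- left, 2(L - 1)N = (c + L)N elements are present, exactly what `extract-many` needs to form a
    -- group from c + 1 = L - 1 extractions.
    group : ∀ q xs → All G xs → Zero w xs → length xs ≡ q ℕ.* (suc c ℕ.* N) →
            ∃ λ gs → xs ↭ concat gs × All (λ g → Zero w g × length g ≡ suc c ℕ.* N) gs
    group zero [] _ _ _ = [] , refl , []
    -- The last group needs no extraction: what remains has the right length, and its sum is zero
    -- because the whole list and all removed groups have sum zero.
    group (suc zero) xs _ xs0 len =
      xs ∷ [] , ↭-reflexive (sym (List.++-identityʳ xs))
      , (xs0 , ≡-trans len (ℕ.*-identityˡ (suc c ℕ.* N))) ∷ []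
    group (suc (suc q)) xs good xs0 len =
      let ys , zs , p , ys0 , leny = extract-many c xs good xs0 big
          gs , p′ , ggs = group (suc q) zs
            (All.++⁻ʳ ys (↭.All-resp-↭ p good)) (Zero-split w ys zs p xs0 ys0)
            (ℕ.+-cancelˡ-≡ (suc c ℕ.* N) _ _
              (≡-trans (cong (ℕ._+ length zs) (sym leny)) (≡-trans (sym (↭-++-length ys p)) len)))
      in ys ∷ gs , trans p (↭.++⁺ˡ ys p′) , (ys0 , leny) ∷ ggs
      where
      big : (c ℕ.+ L) ℕ.* N ℕ.≤ length xs
      big = begin
        (c ℕ.+ L) ℕ.* N             ≡⟨ cong (ℕ._* N) (ℕ.+-suc c (suc c)) ⟩
        (suc c ℕ.+ suc c) ℕ.* N     ≡⟨ ℕ.*-distribʳ-+ N (suc c) (suc c) ⟩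
        G′ ℕ.+ G′                   ≤⟨ ℕ.+-monoʳ-≤ G′ (ℕ.m≤m+n G′ (q ℕ.* G′)) ⟩
        suc (suc q) ℕ.* G′          ≡⟨ len ⟨
        length xs                   ∎
        where
        open ℕ.≤-Reasoning
        G′ = suc c ℕ.* N

-- Zero-sum lists of integers in [-a , a] contain nonempty zero-sum sublists of length
-- at most 2 + excess a, which is 2a - 1 (2 if a = 1): either a and -a both occur and form
-- such a sublist, or the terms lie in an interval that is shorter by one.
excess : ℕ → ℕ
excess zero          = 0
excess (suc zero)    = 0
excess (suc (suc c)) = suc (c ℕ.+ c)

module _ {A : Set} (w : A → ℤ) where

  small-symmetric : ∀ a xs → 1 ℕ.≤ length xs → Within w -[1+ a ] (+ suc a) xs → Zero w xs →
                    Small w (suc (suc (excess (suc a)))) xs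
  -- For terms in [-1, 1] the bound 2a - 1 = 1 would fail on the list 1, -1; the general interval
  -- bound gives 2.
  small-symmetric zero xs ne bd xs0 = small-zero-sum w xs ne bd xs0
  small-symmetric (suc c) xs ne bd xs0
    with pick (λ x → w x ℤ.≟ + suc (suc c)) xs
  ... | inj₁ none = subst (λ L → Small w L xs) (cong (suc ∘ suc) (ℕ.+-suc c c))
    (small-zero-sum w {suc c} {suc c} xs ne
      (All.zipWith (λ { (≢a , lo , hi) → lo , ℤ.i<j⇒i≤pred[j] (ℤ.≤∧≢⇒< hi ≢a) }) (none , bd)) xs0)
  ... | inj₂ (x , ys , wx , p)
    with pick (λ y → w y ℤ.≟ -[1+ suc c ]) ys
  ...   | inj₁ none = small-zero-sum w {suc (suc c)} {c} xs ne
    (All.zipWith (λ { (≢-a , lo , hi) → ℤ.i<j⇒suc[i]≤j (ℤ.≤∧≢⇒< lo (≢-a ∘ sym)) , hi })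
      -- `x` has the value a, which is not -a, so the absence of -a from `ys` extends to all of
      -- `xs`.
      (↭.All-resp-↭ (↭-sym p) ((λ e → contradiction (≡-trans (sym wx) e) λ ()) ∷ none) , bd)) xs0
  ...   | inj₂ (y , zs , wy , q) =
    x ∷ y ∷ [] , zs , trans p (prep x q)
    , ≡-trans (cong₂ (λ s t → s ℤ.+ (t ℤ.+ 0ℤ)) wx wy) (ℤ.+-inverseʳ (+ suc (suc c)))
    , s≤s z≤n , s≤s (s≤s z≤n)

-- Group sizes and the recurrence for m_i

Γ-∣ : ∀ m d → d ℕ.< m → suc d ∣ Γ m
Γ-∣ (suc m) d d<m with d ℕ.≟ m
... | yes refl = m∣lcm[m,n] (suc m) (Γ m)
... | no d≢m = ∣-trans (Γ-∣ m d (ℕ.≤∧≢⇒< (ℕ.≤-pred d<m) d≢m)) (n∣lcm[m,n] (suc m) (Γ m))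

Γ-nonZero : ∀ m → NonZero (Γ m)
Γ-nonZero zero    = _
Γ-nonZero (suc m) = ℕ.m*n≢0⇒n≢0 (gcd (suc m) (Γ m))
  {{subst NonZero (sym (gcd*lcm (suc m) (Γ m))) (ℕ.m*n≢0 (suc m) (Γ m) {{_}} {{Γ-nonZero m}})}}

opaque
  -- This is (L - 1)Γ(L) for L = `excess a + 2`. For a ≥ 2 it equals 2(a - 1)Γ(2a - 1), the factor
  -- by which m_i = a is multiplied to give m_{i+1}. Opacity prevents the least common multiple from
  -- unfolding outside this block.
  grouping : ℕ → ℕ
  grouping a = suc (excess a) ℕ.* Γ (suc (suc (excess a)))

  group-symmetric : ∀ {A : Set} (w : A → ℤ) a xs → Within w (- + suc a) (+ suc a) xs → Zero w xs →
                    grouping (suc a) ∣ length xs →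
                    ∃ λ gs → xs ↭ concat gs × All (λ g → Zero w g × length g ≡ grouping (suc a)) gs
  group-symmetric w a xs bd xs0 (divides q len) =
    group w (excess (suc a)) (Γ L) (Γ-∣ L) (ℕ.>-nonZero⁻¹ (Γ L) {{Γ-nonZero L}})
      (small-symmetric w a) q xs bd xs0 len
    where
    L : ℕ
    L = suc (suc (excess (suc a)))

  grouping-nonZero : ∀ a → NonZero (grouping a)
  grouping-nonZero a = ℕ.m*n≢0 (suc (excess a)) _ {{_}} {{Γ-nonZero (suc (suc (excess a)))}}

  grouping-mseq : ∀ a → 2 ℕ.≤ a → grouping a ℕ.* a ≡ 2 ℕ.* a ℕ.* (a ℕ.∸ 1) ℕ.* Γ (2 ℕ.* a ℕ.∸ 1)
  grouping-mseq (suc zero) (s≤s ())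
  grouping-mseq (suc (suc c)) _ =
    ≡-trans (cong₂ (λ m l → m ℕ.* Γ l ℕ.* suc (suc c)) double index)
            (rearrange (suc (suc c)) (suc c) (Γ (2 ℕ.* suc (suc c) ℕ.∸ 1)))
    where
    double : suc (suc (c ℕ.+ c)) ≡ 2 ℕ.* suc c
    double = cong suc (≡-trans (sym (ℕ.+-suc c c)) (cong (λ t → c ℕ.+ suc t) (sym (ℕ.+-identityʳ c))))
    index : suc (suc (suc (c ℕ.+ c))) ≡ 2 ℕ.* suc (suc c) ℕ.∸ 1
    index = cong suc (≡-trans double (sym (ℕ.+-suc c (suc (c ℕ.+ 0)))))
    rearrange : ∀ a b g → 2 ℕ.* b ℕ.* g ℕ.* a ≡ 2 ℕ.* a ℕ.* b ℕ.* g
    rearrange = ℕRing.solve-∀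

  grouping-1 : grouping 1 ≡ 2
  grouping-1 = refl

-- The start is at single elements. The recurrence for m_i would give 0 at the value 1, whereas
-- `grouping 1` is 2, so the sizes run 1, m_3, m_4, and so on.
blockSize : ℕ → ℕ
blockSize zero    = 1
blockSize (suc k) = grouping (blockSize k) ℕ.* blockSize k

blockSize-nonZero : ∀ k → NonZero (blockSize k)
blockSize-nonZero zero    = _
blockSize-nonZero (suc k) =
  ℕ.m*n≢0 _ _ {{grouping-nonZero (blockSize k)}} {{blockSize-nonZero k}}

grouping-≥2 : ∀ a → 2 ℕ.≤ a → 2 ℕ.≤ grouping a ℕ.* a
grouping-≥2 a h = ℕ.≤-trans h (ℕ.m≤n*m a (grouping a) {{grouping-nonZero a}})

blockSize-≥2 : ∀ k → 2 ℕ.≤ blockSize (suc k)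
blockSize-≥2 zero    = ℕ.≤-reflexive (sym (cong (ℕ._* 1) grouping-1))
blockSize-≥2 (suc k) = grouping-≥2 _ (blockSize-≥2 k)

blockSize-mseq : ∀ k → blockSize (suc k) ≡ mseq (3 ℕ.+ k)
blockSize-mseq zero    = cong (ℕ._* 1) grouping-1
blockSize-mseq (suc k) = ≡-trans (grouping-mseq (blockSize (suc k)) (blockSize-≥2 k))
  (cong (λ a → 2 ℕ.* a ℕ.* (a ℕ.∸ 1) ℕ.* Γ (2 ℕ.* a ℕ.∸ 1)) (blockSize-mseq k))

-- Zero-sum blocks, one coordinate at a time

total-bounded : ∀ {A : Set} (w : A → ℤ) xs → (∀ x → -[1+ 0 ] ℤ.≤ w x × w x ℤ.≤ + 1) →
               - + length xs ℤ.≤ total w xs × total w xs ℤ.≤ + length xs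
total-bounded w [] bd = ℤ.≤-refl , ℤ.≤-refl
total-bounded w (x ∷ xs) bd =
  subst (ℤ._≤ total w (x ∷ xs)) (neg-suc (length xs))
    (ℤ.+-mono-≤ (proj₁ (bd x)) (proj₁ (total-bounded w xs bd)))
  , ℤ.+-mono-≤ (proj₂ (bd x)) (proj₂ (total-bounded w xs bd))
  where
  neg-suc : ∀ n → -[1+ 0 ] ℤ.+ - + n ≡ - + suc n
  neg-suc zero    = refl
  neg-suc (suc n) = refl

Blocks : ∀ {A : Set} {k} → (Fin k → A → ℤ) → ℕ → List A → Set
Blocks f m xs = ∃ λ bs → xs ↭ concat bs × All (λ b → length b ≡ m × ∀ i → Zero (f i) b) bs

-- Each block counts as a single term whose weight is its sum in the new coordinate, an integer in
-- [-m, m]. Grouping these terms makes the new coordinate vanish on the merged blocks, and the old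
-- coordinates vanish on any union of blocks.
merge-blocks : ∀ {A : Set} {k} (f : Fin (suc k) → A → ℤ) →
               (∀ x → -[1+ 0 ] ℤ.≤ f Fin.zero x × f Fin.zero x ℤ.≤ + 1) →
               ∀ m {xs} → Zero (f Fin.zero) xs → NonZero m → grouping m ℕ.* m ∣ length xs →
               Blocks (f ∘ Fin.suc) m xs → Blocks f (grouping m ℕ.* m) xs
merge-blocks f bd (suc a) xs0 _ dvd (bs , p , gbs) =
  let gs , q , ggs = group-symmetric w a bs (All.map (λ {b} → within b ∘ proj₁) gbs) bs0 count∣
      nested = All.concat⁻ (↭.All-resp-↭ q gbs)
  in map concat gs
   , trans p (trans (↭-concat q) (↭-reflexive (sym (List.concat-concat gs))))
   , All.map⁺ (All.zipWith merge (ggs , nested))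
  where
  w = total (f Fin.zero)

  within : ∀ b → length b ≡ suc a → - + suc a ℤ.≤ w b × w b ℤ.≤ + suc a
  within b e = subst (λ l → - + l ℤ.≤ w b × w b ℤ.≤ + l) e (total-bounded (f Fin.zero) b bd)

  bs0 : Zero w bs
  bs0 = ≡-trans (sym (total-concat _ bs)) (≡-trans (sym (total-↭ _ p)) xs0)

  count∣ : grouping (suc a) ∣ length bs
  count∣ = *-cancelʳ-∣ (suc a) (subst (grouping (suc a) ℕ.* suc a ∣_)
    (≡-trans (↭.↭-length p) (length-concat (All.map proj₁ gbs))) dvd)

  merge : ∀ {g} → (Zero w g × length g ≡ grouping (suc a)) ×
                  All (λ b → length b ≡ suc a × ∀ i → Zero (f (Fin.suc i)) b) g →
          length (concat g) ≡ grouping (suc a) ℕ.* suc a × ∀ i → Zero (f i) (concat g)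
  merge {g} ((g0 , len) , good) =
    ≡-trans (length-concat (All.map proj₁ good)) (cong (ℕ._* suc a) len) , λ
      { Fin.zero    → ≡-trans (total-concat _ g) g0
      ; (Fin.suc i) → Zero-concat _ (All.map (λ h → proj₂ h i) good) }

blocks : ∀ {A : Set} k (f : Fin k → A → ℤ) → (∀ i x → -[1+ 0 ] ℤ.≤ f i x × f i x ℤ.≤ + 1) →
         ∀ xs → (∀ i → Zero (f i) xs) → blockSize k ∣ length xs → Blocks f (blockSize k) xs
blocks zero f bd xs _ _ = map (_∷ []) xs , ↭-reflexive (sym (List.concat-map-[_] xs))
                        , All.map⁺ (All.universal (λ x → refl , λ ()) xs)
blocks (suc k) f bd xs xs0 dvd =
  merge-blocks f (bd Fin.zero) (blockSize k) (xs0 Fin.zero) (blockSize-nonZero k) dvd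
    (blocks k (f ∘ Fin.suc) (bd ∘ Fin.suc) xs (xs0 ∘ Fin.suc)
      (∣-trans (n∣m*n (grouping (blockSize k))) dvd))

-- The factor 2 makes the number of blocks even, say 2q; the first `q` blocks form one half and the
-- last `q` the other.
halve : ∀ {A : Set} k (f : Fin k → A → ℤ) → (∀ i x → -[1+ 0 ] ℤ.≤ f i x × f i x ℤ.≤ + 1) →
        ∀ xs → (∀ i → Zero (f i) xs) → 2 ℕ.* blockSize k ∣ length xs →
        ∃₂ λ ys zs → xs ↭ ys ++ zs × length ys ≡ length zs × ∀ i → Zero (f i) ys × Zero (f i) zs
halve k f bd xs xs0 dvd@(divides q len)
  with bs , p , gbs ← blocks k f bd xs xs0 (∣-trans (n∣m*n 2) dvd)
  = concat (take q bs) , concat (drop q bs)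
  , trans p (↭-reflexive (≡-trans (cong concat (sym (List.take++drop≡id q bs)))
                                  (sym (List.concat-++ (take q bs) (drop q bs)))))
  , ≡-trans (length-concat (All.take⁺ q (All.map proj₁ gbs)))
      (≡-trans (cong (ℕ._* m) half) (sym (length-concat (All.drop⁺ q (All.map proj₁ gbs)))))
  , λ i → Zero-concat (f i) (All.take⁺ q (All.map (λ g → proj₂ g i) gbs))
        , Zero-concat (f i) (All.drop⁺ q (All.map (λ g → proj₂ g i) gbs))
  where
  m = blockSize k

  #bs : length bs ≡ q ℕ.+ q
  #bs = ℕ.*-cancelʳ-≡ (length bs) (q ℕ.+ q) m {{blockSize-nonZero k}} (begin
    length bs ℕ.* m      ≡⟨ length-concat (All.map proj₁ gbs) ⟨
    length (concat bs)   ≡⟨ ↭.↭-length p ⟨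
    length xs            ≡⟨ len ⟩
    q ℕ.* (2 ℕ.* m)      ≡⟨ double q m ⟩
    (q ℕ.+ q) ℕ.* m      ∎)
    where
    open ≡-Reasoning
    double : ∀ q m → q ℕ.* (2 ℕ.* m) ≡ (q ℕ.+ q) ℕ.* m
    double = ℕRing.solve-∀

  half : length (take q bs) ≡ length (drop q bs)
  half = begin
    length (take q bs)     ≡⟨ List.length-take q bs ⟩
    q ℕ.⊓ length bs        ≡⟨ ℕ.m≤n⇒m⊓n≡m (subst (q ℕ.≤_) (sym #bs) (ℕ.m≤m+n q q)) ⟩
    q                      ≡⟨ ℕ.m+n∸m≡n q q ⟨
    q ℕ.+ q ℕ.∸ q          ≡⟨ cong (ℕ._∸ q) #bs ⟨
    length bs ℕ.∸ q        ≡⟨ List.length-drop q bs ⟨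
    length (drop q bs)     ∎
    where open ≡-Reasoning

-- Counts as integer sums over lists

total-cong : ∀ {A : Set} {α β : A → ℤ} {xs} → All (λ x → α x ≡ β x) xs → total α xs ≡ total β xs
total-cong []       = refl
total-cong (p ∷ ps) = cong₂ ℤ._+_ p (total-cong ps)

total-+ : ∀ {A : Set} (α β : A → ℤ) xs → total (λ x → α x ℤ.+ β x) xs ≡ total α xs ℤ.+ total β xs
total-+ α β []       = refl
total-+ α β (x ∷ xs) = ≡-trans (cong (λ t → α x ℤ.+ β x ℤ.+ t) (total-+ α β xs))
                               (interchange (α x) (β x) (total α xs) (total β xs))
  where
  interchange : ∀ a b c d → a ℤ.+ b ℤ.+ (c ℤ.+ d) ≡ a ℤ.+ c ℤ.+ (b ℤ.+ d)
  interchange = solve-∀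

total-1 : ∀ {A : Set} (xs : List A) → total (λ _ → + 1) xs ≡ + length xs
total-1 []       = refl
total-1 (x ∷ xs) = cong (λ t → + 1 ℤ.+ t) (total-1 xs)

total-0 : ∀ {A : Set} (xs : List A) → total (λ _ → 0ℤ) xs ≡ 0ℤ
total-0 xs = total-zero _ (All.universal (λ _ → refl) xs)

ind : Bool → ℤ
ind true  = + 1
ind false = 0ℤ

-- Generalised from `allFin` to an arbitrary `f` because the tail of `allFin` is tabulated by `suc`,
-- which puts it outside the special case.
count-tabulate : ∀ {A : Set} {m} (p : A → Bool) (f : Fin m → A) →
                 + count (p ∘ f) ≡ total (ind ∘ p) (tabulate f)
count-tabulate {m = zero}  p f = refl
count-tabulate {m = suc m} p f with p (f Fin.zero)
... | true  = cong (λ t → + 1 ℤ.+ t) (count-tabulate p (f ∘ Fin.suc))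
... | false = ≡-trans (count-tabulate p (f ∘ Fin.suc)) (sym (ℤ.+-identityˡ _))

count-total : ∀ {m} (p : Fin m → Bool) → + count p ≡ total (ind ∘ p) (allFin m)
count-total p = count-tabulate p (λ i → i)

count-+ : ∀ {m} (p q r : Fin m → Bool) → (∀ i → ind (p i) ℤ.+ ind (q i) ≡ ind (r i)) →
          count p ℕ.+ count q ≡ count r
count-+ {m} p q r h = ℤ.+-injective (begin
  + count p ℤ.+ + count q
    ≡⟨ cong₂ ℤ._+_ (count-total p) (count-total q) ⟩
  total (ind ∘ p) (allFin m) ℤ.+ total (ind ∘ q) (allFin m)
    ≡⟨ total-+ (ind ∘ p) (ind ∘ q) (allFin m) ⟨
  total (λ i → ind (p i) ℤ.+ ind (q i)) (allFin m)
    ≡⟨ total-cong (All.universal h (allFin m)) ⟩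
  total (ind ∘ r) (allFin m)
    ≡⟨ count-total r ⟨
  + count r ∎)
  where open ≡-Reasoning

-- A balanced row from a bipartition of the columns

Unique-++-disjoint : ∀ {A : Set} {x : A} xs {ys} → Unique (xs ++ ys) → x ∈ xs → ¬ x ∈ ys
Unique-++-disjoint (_ ∷ xs) (x∉ ∷ _) (here refl) x∈ys = All.lookup x∉ (∈-++⁺ʳ xs x∈ys) refl
Unique-++-disjoint (_ ∷ xs) (_ ∷ u)  (there x∈xs) x∈ys = Unique-++-disjoint xs u x∈xs x∈ys

difference : ∀ {n} → (u v : Fin n → Bool) → Fin n → ℤ
difference u v j = ind (u j == true) - ind (v j == true)

difference-bounds : ∀ {n} (u v : Fin n → Bool) j → -[1+ 0 ] ℤ.≤ difference u v j × difference u v j ℤ.≤ + 1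
difference-bounds u v j with u j | v j
... | true  | true  = -≤+ , +≤+ z≤n
... | true  | false = -≤+ , ℤ.≤-refl
... | false | true  = ℤ.≤-refl , -≤+
... | false | false = -≤+ , +≤+ z≤n

-- The difference vector counts ones only. For zeros the same vector serves with sign -1, so a
-- single zero-sum condition controls both symbols.
total-difference : ∀ {n} (u v : Fin n → Bool) xs b →
  total (λ j → ind (u j == b)) xs ≡ total (λ j → ind (v j == b)) xs ℤ.+
    (ind (b == true) - ind (b == false)) ℤ.* total (difference u v) xs
total-difference u v [] true  = refl
total-difference u v [] false = refl
total-difference u v (x ∷ xs) b =
  ≡-trans (cong₂ ℤ._+_ (pointwise (u x) (v x) b) (total-difference u v xs b))
          (collect (ind (v x == b)) (ind (b == true) - ind (b == false)) (difference u v x)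
                   (total (λ j → ind (v j == b)) xs) (total (difference u v) xs))
  where
  collect : ∀ a s d c e → a ℤ.+ s ℤ.* d ℤ.+ (c ℤ.+ s ℤ.* e) ≡ a ℤ.+ c ℤ.+ s ℤ.* (d ℤ.+ e)
  collect = solve-∀
  pointwise : ∀ p q b → ind (p == b) ≡ ind (q == b) ℤ.+
    (ind (b == true) - ind (b == false)) ℤ.* (ind (p == true) - ind (q == true))
  pointwise true  true  true  = refl
  pointwise true  true  false = refl
  pointwise true  false true  = refl
  pointwise true  false false = refl
  pointwise false true  true  = refl
  pointwise false true  false = refl
  pointwise false false true  = refl
  pointwise false false false = refl

total-agree : ∀ {n} (u v : Fin n → Bool) xs b → Zero (difference u v) xs →
              total (λ j → ind (u j == b)) xs ≡ total (λ j → ind (v j == b)) xs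
total-agree u v xs b xs0 = begin
  total (λ j → ind (u j == b)) xs                        ≡⟨ total-difference u v xs b ⟩
  V ℤ.+ s ℤ.* total (difference u v) xs                  ≡⟨ cong (λ t → V ℤ.+ s ℤ.* t) xs0 ⟩
  V ℤ.+ s ℤ.* 0ℤ                                         ≡⟨ cong (λ t → V ℤ.+ t) (ℤ.*-zeroʳ s) ⟩
  V ℤ.+ 0ℤ                                               ≡⟨ ℤ.+-identityʳ V ⟩
  V                                                      ∎
  where
  open ≡-Reasoning
  V = total (λ j → ind (v j == b)) xs
  s = ind (b == true) - ind (b == false)

module _ {n} (ys zs : List (Fin n)) (perm : allFin n ↭ ys ++ zs) where

  open DecMembership (Fin._≟_ {n}) using (_∈?_)

  membership : Fin n → Bool
  membership j = does (j ∈? ys)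

  -- Since `p` takes the membership bit as an argument, that bit can be replaced by `true` on `ys`
  -- and by `false` on `zs`. The latter needs the two lists disjoint, which holds because `ys ++ zs`
  -- permutes the duplicate-free `allFin n`.
  count-membership : (p : Bool → Fin n → Bool) →
    + count (λ j → p (membership j) j) ≡ total (ind ∘ p true) ys ℤ.+ total (ind ∘ p false) zs
  count-membership p = begin
    + count (λ j → p (membership j) j)       ≡⟨ count-total (λ j → p (membership j) j) ⟩
    total w (allFin n)                       ≡⟨ total-↭ w perm ⟩
    total w (ys ++ zs)                       ≡⟨ total-++ w ys zs ⟩
    total w ys ℤ.+ total w zs                ≡⟨ cong₂ ℤ._+_
      (total-cong (All.tabulate λ {j} j∈ → cong (λ b → ind (p b j)) (dec-true (j ∈? ys) j∈)))
      (total-cong (All.tabulate λ {j} j∈ → cong (λ b → ind (p b j))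
        (dec-false (j ∈? ys) λ j∈ys → Unique-++-disjoint ys unique j∈ys j∈))) ⟩
    total (ind ∘ p true) ys ℤ.+ total (ind ∘ p false) zs ∎
    where
    open ≡-Reasoning
    w : Fin n → ℤ
    w j = ind (p (membership j) j)
    unique : Unique (ys ++ zs)
    unique = ↭ₛ.Unique-resp-↭ (setoid (Fin n)) (↭⇒↭ₛ perm) (allFin⁺ n)

  count-membership-true : count (λ j → membership j == true) ≡ length ys
  count-membership-true = ℤ.+-injective (≡-trans (count-membership (λ b _ → b == true))
    (≡-trans (cong₂ ℤ._+_ (total-1 ys) (total-0 zs)) (ℤ.+-identityʳ _)))

  count-membership-false : count (λ j → membership j == false) ≡ length zs
  count-membership-false = ℤ.+-injective (≡-trans (count-membership (λ b _ → b == false))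
    (≡-trans (cong₂ ℤ._+_ (total-0 ys) (total-1 zs)) (ℤ.+-identityˡ _)))

  -- Fixing `a` restricts the count to `ys` or to `zs`, and on each of them the zero-sum difference
  -- makes `u` and `v` contain `b` equally often.
  count-agree : ∀ (u v : Fin n → Bool) → Zero (difference u v) ys → Zero (difference u v) zs → ∀ a b →
    count (λ j → (membership j == a) ∧ (u j == b)) ≡ count (λ j → (membership j == a) ∧ (v j == b))
  count-agree u v ys0 zs0 a b = ℤ.+-injective (≡-trans (count-membership (λ c j → (c == a) ∧ (u j == b)))
    (≡-trans (parts a) (sym (count-membership (λ c j → (c == a) ∧ (v j == b))))))
    where
    parts : ∀ a →
      total (λ j → ind ((true == a) ∧ (u j == b))) ys ℤ.+ total (λ j → ind ((false == a) ∧ (u j == b))) zs ≡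
      total (λ j → ind ((true == a) ∧ (v j == b))) ys ℤ.+ total (λ j → ind ((false == a) ∧ (v j == b))) zs
    parts true  = cong (ℤ._+ total (λ _ → 0ℤ) zs) (total-agree u v ys b ys0)
    parts false = cong (λ t → total (λ _ → 0ℤ) ys ℤ.+ t) (total-agree u v zs b zs0)

-- `u i` and `v i` stand for two rows of the i-th square. Having equally many ones, they have a
-- zero-sum difference, so `halve` applies to the set of columns; `g` is the indicator of one half.
balanced-row : ∀ k h → 2 ℕ.* blockSize k ∣ h ℕ.+ h → (u v : Fin k → Fin (h ℕ.+ h) → Bool) →
  (∀ i → count (λ j → u i j == true) ≡ count (λ j → v i j == true)) →
  ∃ λ (g : Fin (h ℕ.+ h) → Bool) → (∀ b → count (λ j → g j == b) ≡ h) ×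
    ∀ i a b → count (λ j → (g j == a) ∧ (u i j == b)) ≡ count (λ j → (g j == a) ∧ (v i j == b))
balanced-row k h dvd u v same =
  let ys , zs , perm , len , zeros = halve k
        (λ i → difference (u i) (v i)) (λ i → difference-bounds (u i) (v i))
        (allFin (h ℕ.+ h)) zero-all (subst (2 ℕ.* blockSize k ∣_) (sym (List.length-tabulate (λ j → j))) dvd)
      ys≡h = half (length ys) (≡-trans (cong (λ l → length ys ℕ.+ l) len)
               (≡-trans (sym (↭-++-length ys perm)) (List.length-tabulate (λ j → j))))
  in membership ys zs perm
   , (λ { true  → ≡-trans (count-membership-true ys zs perm) ys≡h
        ; false → ≡-trans (count-membership-false ys zs perm) (≡-trans (sym len) ys≡h) })
   , λ i a b → count-agree ys zs perm (u i) (v i) (proj₁ (zeros i)) (proj₂ (zeros i)) a b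
  where
  half : ∀ l → l ℕ.+ l ≡ h ℕ.+ h → l ≡ h
  half l e = ℕ.*-cancelʳ-≡ l h 2 (≡-trans (twice l) (≡-trans e (sym (twice h))))
    where
    twice : ∀ t → t ℕ.* 2 ≡ t ℕ.+ t
    twice = ℕRing.solve-∀

  zero-all : ∀ i → Zero (difference (u i) (v i)) (allFin (h ℕ.+ h))
  zero-all i = ∙-cancelˡ V _ _ (begin
    V ℤ.+ total (difference (u i) (v i)) all       ≡⟨ cong (λ t → V ℤ.+ t) (ℤ.*-identityˡ _) ⟨
    V ℤ.+ + 1 ℤ.* total (difference (u i) (v i)) all ≡⟨ total-difference (u i) (v i) all true ⟨
    total (λ j → ind (u i j == true)) all          ≡⟨ count-total (λ j → u i j == true) ⟨
    + count (λ j → u i j == true)                  ≡⟨ cong +_ (same i) ⟩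
    + count (λ j → v i j == true)                  ≡⟨ count-total (λ j → v i j == true) ⟩
    V                                              ≡⟨ ℤ.+-identityʳ V ⟨
    V ℤ.+ 0ℤ                                       ∎)
    where
    open ≡-Reasoning
    all = allFin (h ℕ.+ h)
    V = total (λ j → ind (v i j == true)) all

-- Sums over paired rows

sumF-cong : ∀ {m} {f g : Fin m → ℕ} → (∀ i → f i ≡ g i) → sumF f ≡ sumF g
sumF-cong {zero}  e = refl
sumF-cong {suc m} e = cong₂ ℕ._+_ (e Fin.zero) (sumF-cong (e ∘ Fin.suc))

sumF-const : ∀ m c → sumF {m} (λ _ → c) ≡ m ℕ.* c
sumF-const zero    c = refl
sumF-const (suc m) c = cong (λ t → c ℕ.+ t) (sumF-const m c)

sumF-fold : ∀ h {m} (f : Fin (h ℕ.+ m) → ℕ) →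
            sumF f ≡ sumF (λ i → f (i ↑ˡ m)) ℕ.+ sumF (λ i → f (h ↑ʳ i))
sumF-fold zero    f = refl
sumF-fold (suc h) f = ≡-trans (cong (λ t → f Fin.zero ℕ.+ t) (sumF-fold h (f ∘ Fin.suc)))
                              (sym (ℕ.+-assoc (f Fin.zero) _ _))

sumF-+ : ∀ {m} (f g : Fin m → ℕ) → sumF f ℕ.+ sumF g ≡ sumF (λ i → f i ℕ.+ g i)
sumF-+ {zero}  f g = refl
sumF-+ {suc m} f g = ≡-trans (interchange (f Fin.zero) _ (g Fin.zero) _)
  (cong (λ t → f Fin.zero ℕ.+ g Fin.zero ℕ.+ t) (sumF-+ (f ∘ Fin.suc) (g ∘ Fin.suc)))
  where
  interchange : ∀ a b c d → a ℕ.+ b ℕ.+ (c ℕ.+ d) ≡ a ℕ.+ c ℕ.+ (b ℕ.+ d)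
  interchange = ℕRing.solve-∀

-- Used with `c = 1` for the columns of the new square and with `c = h` for orthogonality, each row
-- i being paired with row h + i.
sumF-pairs : ∀ h c (f : Fin (h ℕ.+ h) → ℕ) → (∀ i → f (i ↑ˡ h) ℕ.+ f (h ↑ʳ i) ≡ c) → sumF f ≡ h ℕ.* c
sumF-pairs h c f e = begin
  sumF f                                                    ≡⟨ sumF-fold h f ⟩
  sumF (λ i → f (i ↑ˡ h)) ℕ.+ sumF (λ i → f (h ↑ʳ i))       ≡⟨ sumF-+ (λ i → f (i ↑ˡ h)) _ ⟩
  sumF (λ i → f (i ↑ˡ h) ℕ.+ f (h ↑ʳ i))                    ≡⟨ sumF-cong e ⟩
  sumF {h} (λ _ → c)                                        ≡⟨ sumF-const h c ⟩
  h ℕ.* c                                                   ∎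
  where open ≡-Reasoning

bit : Bool → ℕ
bit true  = 1
bit false = 0

count-sumF : ∀ {m} (p : Fin m → Bool) → count p ≡ sumF (bit ∘ p)
count-sumF {zero}  p = refl
count-sumF {suc m} p with p Fin.zero
... | true  = cong suc (count-sumF (p ∘ Fin.suc))
... | false = count-sumF (p ∘ Fin.suc)

count-cong : ∀ {m} {p q : Fin m → Bool} → (∀ i → p i ≡ q i) → count p ≡ count q
count-cong {p = p} {q} e = ≡-trans (count-sumF p) (≡-trans (sumF-cong (cong bit ∘ e)) (sym (count-sumF q)))

not-== : ∀ x b → (not x == b) ≡ (x == not b)
not-== true  true  = refl
not-== true  false = refl
not-== false true  = refl
not-== false false = refl

bit-complement : ∀ x b → bit (x == b) ℕ.+ bit (not x == b) ≡ 1
bit-complement true  true  = refl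
bit-complement true  false = refl
bit-complement false true  = refl
bit-complement false false = refl

ind-complement : ∀ x a y → ind ((x == a) ∧ y) ℤ.+ ind ((not x == a) ∧ y) ≡ ind y
ind-complement true  true  y = ℤ.+-identityʳ (ind y)
ind-complement true  false y = ℤ.+-identityˡ (ind y)
ind-complement false true  y = ℤ.+-identityˡ (ind y)
ind-complement false false y = ℤ.+-identityʳ (ind y)

twice/2 : ∀ h → (h ℕ.+ h) ℕ./ 2 ≡ h
twice/2 h = ≡-trans (cong (ℕ._/ 2) (twice h)) (m*n/n≡m h 2)
  where
  twice : ∀ t → t ℕ.+ t ≡ t ℕ.* 2
  twice = ℕRing.solve-∀

twice²/4 : ∀ h → (h ℕ.+ h) ℕ.* (h ℕ.+ h) ℕ./ 4 ≡ h ℕ.* h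
twice²/4 h = ≡-trans (cong (ℕ._/ 4) (square h)) (m*n/n≡m (h ℕ.* h) 4)
  where
  square : ∀ t → (t ℕ.+ t) ℕ.* (t ℕ.+ t) ≡ t ℕ.* t ℕ.* 4
  square = ℕRing.solve-∀

-- Complementary rows

module _ (h : ℕ) (g : Fin h → Fin (h ℕ.+ h) → Bool) where

  complementary : Array (h ℕ.+ h)
  complementary r = [ g , (λ i → not ∘ g i) ]′ (splitAt h r)

  complementary-top : ∀ i → complementary (i ↑ˡ h) ≡ g i
  complementary-top i = cong [ g , (λ i → not ∘ g i) ]′ (Fin.splitAt-↑ˡ h i h)

  complementary-bottom : ∀ i → complementary (h ↑ʳ i) ≡ not ∘ g i
  complementary-bottom i = cong [ g , (λ i → not ∘ g i) ]′ (Fin.splitAt-↑ʳ h h i)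

  column : ∀ j b → count (λ r → complementary r j == b) ≡ h
  column j b = ≡-trans (count-sumF (λ r → complementary r j == b))
    (≡-trans (sumF-pairs h 1 (λ r → bit (complementary r j == b)) pair) (ℕ.*-identityʳ h))
    where
    pair : ∀ i → bit (complementary (i ↑ˡ h) j == b) ℕ.+ bit (complementary (h ↑ʳ i) j == b) ≡ 1
    pair i rewrite complementary-top i | complementary-bottom i = bit-complement (g i j) b

  row : (∀ i b → count (λ j → g i j == b) ≡ h) → ∀ r b → count (λ j → complementary r j == b) ≡ h
  row bal r b with splitAt h r
  ... | inj₁ i = bal i b
  ... | inj₂ i = ≡-trans (count-cong (λ j → not-== (g i j) b)) (bal i (not b))

  complementary-IsBFS : (∀ i b → count (λ j → g i j == b) ≡ h) → IsBFS (h ℕ.+ h) complementary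
  complementary-IsBFS bal =
    (λ r → ≡-trans (row bal r false) half , ≡-trans (row bal r true) half) ,
    (λ j → ≡-trans (column j false) half , ≡-trans (column j true) half)
    where half = sym (twice/2 h)

  -- By the agreement hypothesis the upper row of `G` in each pair may be replaced by the lower one.
  -- The row of `g` and its complement then together meet every `b` of that lower row exactly once,
  -- giving h per pair and h * h in all.
  complementary-Orthogonal : ∀ G →
    (∀ r b → count (λ j → G r j == b) ≡ h) →
    (∀ i a b → count (λ j → (g i j == a) ∧ (G (i ↑ˡ h) j == b)) ≡
               count (λ j → (g i j == a) ∧ (G (h ↑ʳ i) j == b))) →
    Orthogonal (h ℕ.+ h) complementary G
  complementary-Orthogonal G bal agree a b =
    ≡-trans (sumF-pairs h h _ pair) (sym (twice²/4 h))
    where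
    pair : ∀ i → count (λ j → (complementary (i ↑ˡ h) j == a) ∧ (G (i ↑ˡ h) j == b)) ℕ.+
                 count (λ j → (complementary (h ↑ʳ i) j == a) ∧ (G (h ↑ʳ i) j == b)) ≡ h
    pair i rewrite complementary-top i | complementary-bottom i | agree i a b =
      ≡-trans (count-+ (λ j → (g i j == a) ∧ (G (h ↑ʳ i) j == b)) _ _
                (λ j → ind-complement (g i j) a (G (h ↑ʳ i) j == b)))
              (bal (h ↑ʳ i) b)

-- The vectors for different row pairs are chosen independently; each choice must only suit all k
-- squares at once.
orthogonal-mate : ∀ k n → 2 ℕ.* blockSize k ∣ n → (∃ λ h → n ≡ h ℕ.+ h) →
  (Fs : Fin k → Array n) → (∀ i → IsBFS n (Fs i)) →
  Σ (Array n) (λ F → IsBFS n F × (∀ i → Orthogonal n F (Fs i)))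
orthogonal-mate k _ dvd (h , refl) Fs bfs =
  complementary h g
  , complementary-IsBFS h g (λ i → proj₁ (proj₂ (choice i)))
  , λ i → complementary-Orthogonal h g (Fs i) (rows i) (λ r → proj₂ (proj₂ (choice r)) i)
  where
  rows : ∀ i r b → count (λ j → Fs i r j == b) ≡ h
  rows i r true  = ≡-trans (proj₂ (proj₁ (bfs i) r)) (twice/2 h)
  rows i r false = ≡-trans (proj₁ (proj₁ (bfs i) r)) (twice/2 h)

  choice : ∀ (r : Fin h) → _
  choice r = balanced-row k h dvd (λ i → Fs i (r ↑ˡ h)) (λ i → Fs i (h ↑ʳ r))
    (λ i → ≡-trans (rows i (r ↑ˡ h) true) (sym (rows i (h ↑ʳ r) true)))

  g : Fin h → Fin (h ℕ.+ h) → Bool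
  g r = proj₁ (choice r)

-- Comparing block sizes with m_{2k}

mseq-∣-suc : ∀ i → mseq i ∣ mseq (suc i)
mseq-∣-suc 0 = ∣-refl
mseq-∣-suc 1 = ∣-refl
mseq-∣-suc 2 = 1∣ 2
mseq-∣-suc (suc (suc (suc i))) = divides-product (mseq (3 ℕ.+ i)) (Γ (2 ℕ.* mseq (3 ℕ.+ i) ℕ.∸ 1))
  where
  divides-product : ∀ a c → a ∣ 2 ℕ.* a ℕ.* (a ℕ.∸ 1) ℕ.* c
  divides-product a c = ∣m⇒∣m*n c (∣m⇒∣m*n (a ℕ.∸ 1) (n∣m*n 2))

mseq-∣-+ : ∀ i d → mseq i ∣ mseq (d ℕ.+ i)
mseq-∣-+ i zero    = ∣-refl
mseq-∣-+ i (suc d) = ∣-trans (mseq-∣-+ i d) (mseq-∣-suc (d ℕ.+ i))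

2blockSize∣4mseq : ∀ k → 1 ℕ.≤ k → 2 ℕ.* blockSize k ∣ 4 ℕ.* mseq (2 ℕ.* k)
-- For one square the index 2k = 2 is smaller than k + 2 = 3; here 2 m_3 and 4 m_2 are both 4.
2blockSize∣4mseq (suc zero)    _ = subst (λ b → 2 ℕ.* b ∣ 4) (sym (blockSize-mseq 0)) ∣-refl
-- From two squares on, k + 2 is at most 2k, so m_{k+2} divides m_{2k} along the divisibility chain.
2blockSize∣4mseq (suc (suc k)) _ = *-pres-∣ {2} {4} (divides 2 refl)
  (subst₂ (λ b i → b ∣ mseq i) (sym (blockSize-mseq (suc k))) (index k) (mseq-∣-+ (4 ℕ.+ k) k))
  where
  index : ∀ k → k ℕ.+ (4 ℕ.+ k) ≡ 2 ℕ.* suc (suc k)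
  index = ℕRing.solve-∀

theorem3p2 : (k n : ℕ) → 1 ≤ k → 1 ≤ n →
    4 * mseq (2 * k) ∣ n →
    (Fs : Fin k → Array n) → (∀ i → IsBFS n (Fs i)) →
    Σ (Array n) (λ F → IsBFS n F × (∀ i → Orthogonal n F (Fs i)))
theorem3p2 k n k≥1 _ dvd = orthogonal-mate k n 2b∣n (half (∣-trans (m∣m*n (blockSize k)) 2b∣n))
  where
  2b∣n : 2 * blockSize k ∣ n
  2b∣n = ∣-trans (2blockSize∣4mseq k k≥1) dvd

  half : 2 ∣ n → ∃ λ h → n ≡ h ℕ.+ h
  half (divides h e) = h , ≡-trans e (twice h)
    where
    twice : ∀ t → t ℕ.* 2 ≡ t ℕ.+ t
    twice = ℕRing.solve-∀
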